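{- For every $\Gamma\cup\{\varphi\}\subseteq For(\Sigma^{C_1}_D)$, if $\Gamma\vdash_{C^D_1}\varphi$, then $\Gamma\vDash_{C^D_1}\varphi$.
   Context: **Syntax.** $For(\Sigma^{C_1}_D)$ is the set of formulas generated from a denumerable set of propositional variables by the signature $\Sigma^{C_1}_D=\{\to,\neg,\lor,\land,\mathsf{O}\}$ ($\neg,\mathsf{O}$ unary; $\to,\lor,\land$ binary). Abbreviation: $\alpha^\circ:=\neg(\alpha\land\neg\alpha)$. **The logic $C^D_1$.** Hilbert calculus whose axiom schemas are those of $CPL^+$, the positive fragment of classical propositional logic in $\to,\land,\lor$ (for instance: $\alpha\to(\beta\to\alpha)$; $(\alpha\to(\beta\to\gamma))\to((\alpha\to\beta)\to(\alpha\to\gamma))$; $\alpha\to(\beta\to(\alpha\land\beta))$; $(\alpha\land\beta)\to\alpha$; $(\alpha\land\beta)\to\beta$; $\alpha\to(\alpha\lor\beta)$; $\beta\to(\alpha\lor\beta)$; $(\alpha\to\gamma)\to((\beta\to\gamma)\to((\alpha\lor\beta)\to\gamma))$; $\alpha\lor(\alpha\to\beta)$), plus - (EM) $\alpha\lor\neg\alpha$; (cf) $\neg\neg\alpha\to\alpha$; - (bc)' $\alpha^\circ\to(\alpha\to(\neg\alpha\to\beta))$; - (ca$_\#$)' $(\alpha^\circ\land\beta^\circ)\to(\alpha\#\beta)^\circ$ for each $\#\in\{\land,\lor,\to\}$; - ($\mathsf{O}$-K) $\mathsf{O}(\alpha\to\beta)\to(\mathsf{O}\alpha\to\mathsf{O}\beta)$;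 - ($\mathsf{O}$-E) $\mathsf{O}\bot_\alpha\to\bot_\alpha$, where $\bot_\alpha:=(\alpha\land\neg\alpha)\land\alpha^\circ$; - (ca$_{\mathsf{O}}$)' $\alpha^\circ\to(\mathsf{O}\alpha)^\circ$. The rules are Modus Ponens and $\mathsf{O}$-necessitation (from $\varphi$ infer $\mathsf{O}\varphi$). $\vdash_{C^D_1}\varphi$ means that there is a finite derivation of $\varphi$ from axioms (no premises) using the rules. $\Gamma\vdash_{C^D_1}\varphi$ means: either $\vdash_{C^D_1}\varphi$, or there are $\gamma_1,\dots,\gamma_k\in\Gamma$ ($k\ge 1$ finite) with $\vdash_{C^D_1}(\gamma_1\land\dots\land\gamma_k)\to\varphi$. **Semantics.** Let $A=\{T,t,F\}$ with $T=(1,0)$, $t=(1,1)$, $F=(0,1)$; for $a\in A$ write $a=(a_1,a_2)$. Designated values: $\mathcal{D}=\{T,t\}$. Let $\sqcap,\sqcup,\supset$ be the Boolean meet, join and implication on $\{0,1\}$, and $\bigwedge$ the meet of a non-empty subset. For $a,b\in A$, $\emptyset\neq X\subseteq A$: - $a\,\tilde\land\,b=\{c\in A: c_1=a_1\sqcap b_1\}$; $a\,\tilde\lor\,b=\{c\in A: c_1=a_1\sqcup b_1\}$; $a\,\tilde\to\,b=\{c\in A: c_1=a_1\supset b_1\}$; - $\tilde\neg_1 a=\{c\in A: c_1=a_2\text{ and }c_2\le a_1\}$; - $\tilde{\mathsf{O}}(X)=\{c\in A: c_1=\bigwedge\{x_1:x\in X\}\}$. A swap Kripke model for $C^D_1$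 is a triple $\langle W,R,\{v_w\}_{w\in W}\rangle$ where $W\ne\emptyset$, $R\subseteq W^2$ is serial (every $w$ has some $w'$ with $wRw'$), and each $v_w:For(\Sigma^{C_1}_D)\to A$ satisfies, for all $\alpha,\beta$ and all $\#\in\{\land,\lor,\to\}$: - $v_w(\alpha\#\beta)\in v_w(\alpha)\,\tilde\#\,v_w(\beta)$; $v_w(\neg\alpha)\in\tilde\neg_1 v_w(\alpha)$; $v_w(\mathsf{O}\alpha)\in\tilde{\mathsf{O}}(\{v_{w'}(\alpha): wRw'\})$; - if $v_w(\alpha)=t$ then $v_w(\alpha\land\neg\alpha)=T$; - if $v_w(\alpha),v_w(\beta)\in\{T,F\}$ then $v_w(\alpha\#\beta)\in\{T,F\}$; - if $v_w(\alpha)\in\{T,F\}$ then $v_w(\mathsf{O}\alpha)\in\{T,F\}$. $\mathcal{M},w\vDash\alpha$ means $v_w(\alpha)\in\mathcal{D}$; $\mathcal{M},w\vDash\Gamma$ means $\mathcal{M},w\vDash\gamma$ for all $\gamma\in\Gamma$. $\Gamma\vDash_{C^D_1}\alpha$ means: for every swap Kripke model $\mathcal{M}$ for $C^D_1$ and every world $w$ of it, $\mathcal{M},w\vDash\Gamma$ implies $\mathcal{M},w\vDash\alpha$. -}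

module Defs where

open import Data.Bool.Base using (Bool; true; false; not; _∧_; _∨_; _≤_)
open import Data.List.NonEmpty.Base using (List⁺; foldr₁)
open import Data.List.NonEmpty.Relation.Unary.All using (All)
open import Data.Nat.Base using (ℕ)
open import Data.Product.Base using (∃; ∃-syntax; _×_)
open import Data.Sum.Base using (_⊎_)
open import Level using (Level; 0ℓ; _⊔_) renaming (suc to lsuc)
open import Relation.Binary.Core using (Rel)
open import Relation.Binary.PropositionalEquality.Core using (_≡_)
open import Relation.Unary using (Pred; _∈_; _∪_; ｛_｝)

private
  variable
    ℓ : Level

------------------------------------------------------------------------
-- Syntax

data Op : Set where
  and or imp : Op

infixr 5 _⇒_
infixr 6 _⋎_
infixr 7 _⋏_
infix  8 ~_
infix  9 _°

data Form : Set where
  var : ℕ → Form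
  ~_  : Form → Form
  O   : Form → Form
  bin : Op → Form → Form → Form

pattern _⋏_ α β = bin and α β
pattern _⋎_ α β = bin or α β
pattern _⇒_ α β = bin imp α β

_° : Form → Form
α ° = ~ (α ⋏ ~ α)

Bot : Form → Form
Bot α = (α ⋏ ~ α) ⋏ α °

------------------------------------------------------------------------
-- The Hilbert calculus C₁ᴰ

data Axiom : Form → Set where
  K     : ∀ α β   → Axiom (α ⇒ (β ⇒ α))
  S     : ∀ α β γ → Axiom ((α ⇒ (β ⇒ γ)) ⇒ ((α ⇒ β) ⇒ (α ⇒ γ)))
  ∧-I   : ∀ α β   → Axiom (α ⇒ (β ⇒ (α ⋏ β)))
  ∧-E₁  : ∀ α β   → Axiom ((α ⋏ β) ⇒ α)
  ∧-E₂  : ∀ α β   → Axiom ((α ⋏ β) ⇒ β)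
  ∨-I₁  : ∀ α β   → Axiom (α ⇒ (α ⋎ β))
  ∨-I₂  : ∀ α β   → Axiom (β ⇒ (α ⋎ β))
  ∨-E   : ∀ α β γ → Axiom ((α ⇒ γ) ⇒ ((β ⇒ γ) ⇒ ((α ⋎ β) ⇒ γ)))
  ∨-⇒   : ∀ α β   → Axiom (α ⋎ (α ⇒ β))
  EM    : ∀ α     → Axiom (α ⋎ ~ α)
  cf    : ∀ α     → Axiom ((~ ~ α) ⇒ α)
  bc    : ∀ α β   → Axiom (α ° ⇒ (α ⇒ (~ α ⇒ β)))
  ca    : ∀ # α β → Axiom ((α ° ⋏ β °) ⇒ (bin # α β) °)
  O-K   : ∀ α β   → Axiom (O (α ⇒ β) ⇒ (O α ⇒ O β))
  O-E   : ∀ α     → Axiom (O (Bot α) ⇒ Bot α)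
  ca-O  : ∀ α     → Axiom (α ° ⇒ (O α) °)

infix 4 ⊢_ _⊢_ _⊨[_,_]_

data ⊢_ : Form → Set where
  ax  : ∀ {φ}   → Axiom φ → ⊢ φ
  mp  : ∀ {φ ψ} → ⊢ φ ⇒ ψ → ⊢ φ → ⊢ ψ
  nec : ∀ {φ}   → ⊢ φ → ⊢ O φ

-- Necessitation only applies to theorems, so premises enter solely through
-- the conjunction γ₁ ∧ (γ₂ ∧ (… ∧ γₖ)), k ≥ 1.
_⊢_ : Pred Form ℓ → Form → Set ℓ
Γ ⊢ φ = (⊢ φ) ⊎ (∃[ γs ] All (_∈ Γ) γs × (⊢ foldr₁ (bin and) γs ⇒ φ))

------------------------------------------------------------------------
-- Snapshots and multioperations

data A : Set where
  T t F : A

infix 10 _₁ _₂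

_₁ : A → Bool
T ₁ = true
t ₁ = true
F ₁ = false

_₂ : A → Bool
T ₂ = false
t ₂ = true
F ₂ = true

Designated : Pred A 0ℓ
Designated = ｛ T ｝ ∪ ｛ t ｝

Classical : Pred A 0ℓ
Classical = ｛ T ｝ ∪ ｛ F ｝

boolOp : Op → Bool → Bool → Bool
boolOp and x y = x ∧ y
boolOp or  x y = x ∨ y
boolOp imp x y = not x ∨ y

binᴬ : Op → A → A → Pred A 0ℓ
binᴬ # a b c = c ₁ ≡ boolOp # (a ₁) (b ₁)

~ᴬ : A → Pred A 0ℓ
~ᴬ a c = c ₁ ≡ a ₂ × c ₂ ≤ a ₁

-- b is the meet of X: its greatest lower bound in the order false ≤ true.
-- A relation rather than a function, since the meet of an arbitrary
-- X : Pred Bool ℓ is not computable.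
IsMeet : Pred Bool ℓ → Pred Bool ℓ
IsMeet X b = (∀ {x} → x ∈ X → b ≤ x)
           × (∀ b′ → (∀ {x} → x ∈ X → b′ ≤ x) → b′ ≤ b)

-- Only used for inhabited X, by seriality of the accessibility relation.
Oᴬ : Pred A ℓ → Pred A ℓ
Oᴬ X c = IsMeet (λ b → ∃[ x ] x ∈ X × b ≡ x ₁) (c ₁)

------------------------------------------------------------------------
-- Swap Kripke models

record SwapKripkeModel (w r : Level) : Set (lsuc (w ⊔ r)) where
  field
    W        : Set w
    nonempty : W
    R        : Rel W r
    serial   : ∀ u → ∃[ u′ ] R u u′
    v        : W → Form → A

    v-bin : ∀ u # α β → v u (bin # α β) ∈ binᴬ # (v u α) (v u β)
    v-~   : ∀ u α → v u (~ α) ∈ ~ᴬ (v u α)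
    v-O   : ∀ u α → v u (O α) ∈ Oᴬ (λ x → ∃[ u′ ] R u u′ × x ≡ v u′ α)

    v-t           : ∀ u α → v u α ≡ t → v u (α ⋏ ~ α) ≡ T
    v-bin-classic : ∀ u # α β → v u α ∈ Classical → v u β ∈ Classical →
                    v u (bin # α β) ∈ Classical
    v-O-classic   : ∀ u α → v u α ∈ Classical → v u (O α) ∈ Classical

_,_⊨_ : ∀ {w r} (M : SwapKripkeModel w r) → SwapKripkeModel.W M → Form → Set
M , u ⊨ α = SwapKripkeModel.v M u α ∈ Designated

-- The levels are those of the worlds and of the accessibility relation of the
-- models quantified over.
_⊨[_,_]_ : Pred Form ℓ → (w r : Level) → Form → Set (ℓ ⊔ lsuc (w ⊔ r))
Γ ⊨[ w , r ] α = (M : SwapKripkeModel w r) (u : SwapKripkeModel.W M) →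
                 (∀ {γ} → γ ∈ Γ → M , u ⊨ γ) → M , u ⊨ α

{-# OPTIONS --safe #-}

-- A formula is designated at a world iff the first coordinate of its value is
-- 1. Designation therefore obeys the classical clauses for ⇒, ⋏, ⋎ and the
-- Kripke clause for O, which validates CPL⁺, O-K and necessitation; EM and cf
-- are read off the clause for ~. The other axioms hold because α ° is
-- designated exactly where the value of α is classical: the condition on t
-- gives one direction, the truth tables the other.

module Submission where

open import Defs
open import Data.Bool.Base using (true; false; not; _∧_; _∨_; _≤_; b≤b)
open import Data.Bool.Properties using (∧-conicalˡ; ∧-conicalʳ; ∨-zeroʳ; ≤-reflexive)
open import Data.List.NonEmpty.Base using (_∷_; foldr₁)
open import Data.List.NonEmpty.Relation.Unary.All using (_∷_)
open import Data.List.Relation.Unary.All using (All; []; _∷_; map)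
open import Data.Product.Base using (_,_; proj₁; proj₂)
open import Data.Sum.Base using (_⊎_; inj₁; inj₂; [_,_]′)
open import Function.Base using (_∘_)
open import Relation.Binary.PropositionalEquality
  using (_≡_; refl; sym; trans; cong; cong₂)
open import Relation.Nullary using (¬_; contradiction)
open import Relation.Unary using (Pred; _∈_)

true-≤ : ∀ {x y} → x ≤ y → x ≡ true → y ≡ true
true-≤ b≤b x≡true = x≡true

⊃-intro : ∀ x {y} → (x ≡ true → y ≡ true) → not x ∨ y ≡ true
⊃-intro true  f = f refl
⊃-intro false f = refl

⊃-elim : ∀ {x y} → not x ∨ y ≡ true → x ≡ true → y ≡ true
⊃-elim p refl = p

∨-split : ∀ x {y} → x ∨ y ≡ true → x ≡ true ⊎ y ≡ true
∨-split true  p = inj₁ refl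
∨-split false p = inj₂ p

excluded-middle-⊃ : ∀ x y → x ∨ (not x ∨ y) ≡ true
excluded-middle-⊃ true  y = refl
excluded-middle-⊃ false y = refl

-- The pair (0,0) is not a snapshot; this is what validates `EM`.
₁∨₂ : ∀ a → a ₁ ∨ a ₂ ≡ true
₁∨₂ T = refl
₁∨₂ t = refl
₁∨₂ F = refl

classical⇒₁∧₂ : ∀ {a} → a ∈ Classical → a ₁ ∧ a ₂ ≡ false
classical⇒₁∧₂ (inj₁ refl) = refl
classical⇒₁∧₂ (inj₂ refl) = refl

₁-false⇒₂ : ∀ a → a ₁ ≡ false → a ₂ ≡ true
₁-false⇒₂ F refl = refl

t⊎classical : ∀ a → a ≡ t ⊎ a ∈ Classical
t⊎classical T = inj₂ (inj₁ refl)
t⊎classical t = inj₁ refl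
t⊎classical F = inj₂ (inj₂ refl)

₁⇒designated : ∀ a → a ₁ ≡ true → a ∈ Designated
₁⇒designated T refl = inj₁ refl
₁⇒designated t refl = inj₂ refl

designated⇒₁ : ∀ {a} → a ∈ Designated → a ₁ ≡ true
designated⇒₁ (inj₁ refl) = refl
designated⇒₁ (inj₂ refl) = refl

module _ {w r} (M : SwapKripkeModel w r) where
  open SwapKripkeModel M

  infix 4 _⊩_

  -- Designation as a Boolean equation, so that it chains by `trans` with the clauses of the model.
  _⊩_ : W → Form → Set
  u ⊩ α = v u α ₁ ≡ true

  module _ {u : W} where

    ⇒-intro : ∀ {α β} → (u ⊩ α → u ⊩ β) → u ⊩ α ⇒ β
    ⇒-intro {α} {β} f = trans (v-bin u imp α β) (⊃-intro (v u α ₁) f)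

    ⇒-elim : ∀ {α β} → u ⊩ α ⇒ β → u ⊩ α → u ⊩ β
    ⇒-elim {α} {β} p = ⊃-elim (trans (sym (v-bin u imp α β)) p)

    ⋏-intro : ∀ {α β} → u ⊩ α → u ⊩ β → u ⊩ α ⋏ β
    ⋏-intro {α} {β} p q = trans (v-bin u and α β) (cong₂ _∧_ p q)

    ⋏-elim₁ : ∀ {α β} → u ⊩ α ⋏ β → u ⊩ α
    ⋏-elim₁ {α} {β} p =
      ∧-conicalˡ (v u α ₁) (v u β ₁) (trans (sym (v-bin u and α β)) p)

    ⋏-elim₂ : ∀ {α β} → u ⊩ α ⋏ β → u ⊩ β
    ⋏-elim₂ {α} {β} p =
      ∧-conicalʳ (v u α ₁) (v u β ₁) (trans (sym (v-bin u and α β)) p)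

    ⋀-intro : ∀ {γ γs} → u ⊩ γ → All (u ⊩_) γs → u ⊩ foldr₁ (bin and) (γ ∷ γs)
    ⋀-intro p []       = p
    ⋀-intro p (q ∷ qs) = ⋏-intro p (⋀-intro q qs)

    ⋎-intro₁ : ∀ {α β} → u ⊩ α → u ⊩ α ⋎ β
    ⋎-intro₁ {α} {β} p = trans (v-bin u or α β) (cong (_∨ v u β ₁) p)

    ⋎-intro₂ : ∀ {α β} → u ⊩ β → u ⊩ α ⋎ β
    ⋎-intro₂ {α} {β} p =
      trans (v-bin u or α β) (trans (cong (v u α ₁ ∨_) p) (∨-zeroʳ (v u α ₁)))

    ⋎-elim : ∀ {α β} → u ⊩ α ⋎ β → u ⊩ α ⊎ u ⊩ β
    ⋎-elim {α} {β} p = ∨-split (v u α ₁) (trans (sym (v-bin u or α β)) p)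

    ⋎-⇒ : ∀ α β → u ⊩ α ⋎ (α ⇒ β)
    ⋎-⇒ α β = trans (v-bin u or α (α ⇒ β))
      (trans (cong (v u α ₁ ∨_) (v-bin u imp α β))
             (excluded-middle-⊃ (v u α ₁) (v u β ₁)))

    ⋎-~ : ∀ α → u ⊩ α ⋎ ~ α
    ⋎-~ α = trans (v-bin u or α (~ α))
      (trans (cong (v u α ₁ ∨_) (proj₁ (v-~ u α))) (₁∨₂ (v u α)))

    -- The first coordinate of `~ ~ α` is the second of `~ α`, which the other half of the clause
    -- for negation bounds by the first of `α`.
    ~~-elim : ∀ {α} → u ⊩ ~ ~ α → u ⊩ α
    ~~-elim {α} p =
      true-≤ (proj₂ (v-~ u α)) (trans (sym (proj₁ (v-~ u (~ α)))) p)

    v-contradiction : ∀ α → v u (α ⋏ ~ α) ₁ ≡ v u α ₁ ∧ v u α ₂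
    v-contradiction α =
      trans (v-bin u and α (~ α)) (cong (v u α ₁ ∧_) (proj₁ (v-~ u α)))

    °⇒classical : ∀ {α} → u ⊩ α ° → v u α ∈ Classical
    °⇒classical {α} p with t⊎classical (v u α)
    ... | inj₂ c  = c
    -- At `t` the contradiction `α ⋏ ~ α` would take the value `T`, whose second coordinate 0 is the
    -- first coordinate of `α °`.
    ... | inj₁ vt = contradiction
      (trans (sym p) (trans (proj₁ (v-~ u (α ⋏ ~ α))) (cong _₂ (v-t u α vt))))
      λ ()

    -- Only `t` has both coordinates 1, so here `α ⋏ ~ α` takes the value `F`, whose second
    -- coordinate is 1.
    classical⇒° : ∀ {α} → v u α ∈ Classical → u ⊩ α °
    classical⇒° {α} c = trans (proj₁ (v-~ u (α ⋏ ~ α)))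
      (₁-false⇒₂ (v u (α ⋏ ~ α)) (trans (v-contradiction α) (classical⇒₁∧₂ c)))

    explosion : ∀ {α} → u ⊩ α ° → ¬ (u ⊩ α ⋏ ~ α)
    explosion {α} p q = contradiction
      (trans (sym q) (trans (v-contradiction α) (classical⇒₁∧₂ (°⇒classical p))))
      λ ()

    ⊮Bot : ∀ {α} → ¬ (u ⊩ Bot α)
    ⊮Bot p = explosion (⋏-elim₂ p) (⋏-elim₁ p)

    O-intro : ∀ {α} → (∀ {u′} → R u u′ → u′ ⊩ α) → u ⊩ O α
    -- `true` is a lower bound of the first coordinates at the successors, hence lies below their
    -- meet.
    O-intro {α} f = true-≤
      (proj₂ (v-O u α) true λ { (_ , (_ , Ru , refl) , refl) → ≤-reflexive (sym (f Ru)) })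
      refl

    O-elim : ∀ {α} → u ⊩ O α → ∀ {u′} → R u u′ → u′ ⊩ α
    O-elim {α} p Ru = true-≤ (proj₁ (v-O u α) (_ , (_ , Ru , refl) , refl)) p

  module _ {u : W} where

    axiom-sound : ∀ {φ} → Axiom φ → u ⊩ φ
    axiom-sound (K α β)     = ⇒-intro λ p → ⇒-intro λ _ → p
    axiom-sound (S α β γ)   = ⇒-intro λ p → ⇒-intro λ q → ⇒-intro λ x →
      ⇒-elim (⇒-elim p x) (⇒-elim q x)
    axiom-sound (∧-I α β)   = ⇒-intro λ p → ⇒-intro λ q → ⋏-intro p q
    axiom-sound (∧-E₁ α β)  = ⇒-intro ⋏-elim₁
    axiom-sound (∧-E₂ α β)  = ⇒-intro ⋏-elim₂
    axiom-sound (∨-I₁ α β)  = ⇒-intro ⋎-intro₁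
    axiom-sound (∨-I₂ α β)  = ⇒-intro ⋎-intro₂
    axiom-sound (∨-E α β γ) = ⇒-intro λ p → ⇒-intro λ q → ⇒-intro λ x →
      [ ⇒-elim p , ⇒-elim q ]′ (⋎-elim x)
    axiom-sound (∨-⇒ α β)   = ⋎-⇒ α β
    axiom-sound (EM α)      = ⋎-~ α
    axiom-sound (cf α)      = ⇒-intro ~~-elim
    axiom-sound (bc α β)    = ⇒-intro λ p → ⇒-intro λ x → ⇒-intro λ y →
      contradiction (⋏-intro x y) (explosion p)
    axiom-sound (ca # α β)  = ⇒-intro λ p → classical⇒°
      (v-bin-classic u # α β (°⇒classical (⋏-elim₁ p)) (°⇒classical (⋏-elim₂ p)))
    axiom-sound (O-K α β)   = ⇒-intro λ p → ⇒-intro λ q → O-intro λ Ru →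
      ⇒-elim (O-elim p Ru) (O-elim q Ru)
    -- The implication holds vacuously: seriality provides a successor, at which `Bot α` would have
    -- to be designated.
    axiom-sound (O-E α)     = ⇒-intro λ p →
      contradiction (O-elim p (proj₂ (serial u))) ⊮Bot
    axiom-sound (ca-O α)    = ⇒-intro λ p →
      classical⇒° (v-O-classic u α (°⇒classical p))

  -- The world is quantified after the derivation, so that in the case `nec` the induction
  -- hypothesis is available at every successor.
  ⊢-sound : ∀ {φ} → ⊢ φ → ∀ {u} → u ⊩ φ
  ⊢-sound (ax a)   = axiom-sound a
  ⊢-sound (mp d e) = ⇒-elim (⊢-sound d) (⊢-sound e)
  ⊢-sound (nec d)  = O-intro λ _ → ⊢-sound d

theorem6p2 : ∀ {ℓ w r} (Γ : Pred Form ℓ) (φ : Form) → Γ ⊢ φ → Γ ⊨[ w , r ] φ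
theorem6p2 Γ φ (inj₁ d) M u _ = ₁⇒designated _ (⊢-sound M d)
theorem6p2 Γ φ (inj₂ (_ , γ∈Γ ∷ γs∈Γ , d)) M u u⊨Γ = ₁⇒designated _
  (⇒-elim M (⊢-sound M d) (⋀-intro M (u⊩ γ∈Γ) (map u⊩ γs∈Γ)))
  where
  u⊩ : ∀ {γ} → γ ∈ Γ → SwapKripkeModel.v M u γ ₁ ≡ true
  u⊩ = designated⇒₁ ∘ u⊨Γ
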